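{- Let $\mathcal{D}$ be a $2-(v,k,1)$ design with replication number $r=\frac{v-1}{k-1}$, and let $\mathcal{S}$ be an Erdős-Ko-Rado set on $\mathcal{D}$. If $r\geq k^{2}-k+1$, then $|\mathcal{S}|\leq r$. If $r> k^{2}-k+1$ and $|\mathcal{S}|=r$, then $\mathcal{S}$ is a point-pencil.
   Context: A $2-(v,k,1)$ design, with integers $v>k>1$, consists of a set $\mathcal{P}$ of $v$ points together with a set $\mathcal{B}$ of $k$-subsets of $\mathcal{P}$ (blocks) such that any two distinct points are contained in exactly one block. Every point then lies on exactly $r=\frac{v-1}{k-1}$ blocks. An Erdős-Ko-Rado set on a design is a set of pairwise intersecting blocks. A point-pencil is the set of all blocks through a fixed point. -}

module Defs where

open import Data.Fin.Base using (Fin)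
open import Data.Fin.Subset using (Subset; _∈_; _∩_; ∣_∣; Nonempty)
open import Data.Nat.Base using (ℕ; _<_; _∸_; _/_; NonZero; >-nonZero)
open import Data.Nat.Properties using (m<n⇒0<n∸m)
open import Data.Product.Base using (_×_; ∃-syntax)
open import Data.Product using (∃!)
open import Function.Bundles using (_⇔_)
open import Function.Definitions using (Injective)
open import Relation.Binary.PropositionalEquality using (_≡_; _≢_)

-- A 2-(v,k,1) design on the point set Fin v. The set of blocks is given by an
-- injective enumeration, so sets of blocks are subsets of the index set Fin b.
record Design (v k : ℕ) : Set where
  field
    1<k             : 1 < k
    k<v             : k < v
    b               : ℕ
    block           : Fin b → Subset v
    block-injective : Injective _≡_ _≡_ block
    block-size      : ∀ i → ∣ block i ∣ ≡ k
    block-through   : ∀ {x y} → x ≢ y → ∃! _≡_ λ i → x ∈ block i × y ∈ block i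

  k∸1-nonZero : NonZero (k ∸ 1)
  k∸1-nonZero = >-nonZero (m<n⇒0<n∸m 1<k)

  -- Nothing is rounded here: double counting shows that k ∸ 1 divides v ∸ 1
  -- in every design.
  replication : ℕ
  replication = _/_ (v ∸ 1) (k ∸ 1) {{k∸1-nonZero}}

  IsErdősKoRado : Subset b → Set
  IsErdősKoRado S =
    ∀ {i j} → i ∈ S → j ∈ S → i ≢ j → Nonempty (block i ∩ block j)

  IsPointPencil : Subset b → Set
  IsPointPencil S = ∃[ x ] (∀ i → i ∈ S ⇔ x ∈ block i)

{-# OPTIONS --safe #-}
-- If some point x lies on more than k blocks of S, then every block of S
-- contains x: the blocks of S through x would meet a block avoiding x in
-- pairwise distinct points. Hence S lies in the pencil of x, which has at most
-- r blocks. Otherwise every point of a fixed block of S lies on at most k - 1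
-- other blocks of S, and all blocks of S meet the fixed one, so
-- ∣ S ∣ ≤ 1 + k (k - 1).
module Submission where

open import Defs
open import Data.Nat.Base using (ℕ; _+_; _∸_; _^_; _≤_; _≥_; _>_)
open import Data.Fin.Subset using (Subset; ∣_∣)
open import Data.Product.Base using (_×_)
open import Relation.Binary.PropositionalEquality using (_≡_)

open import Data.Bool.Base using (Bool; true; false; _∧_)
open import Data.Fin.Base using (Fin; zero; suc)
open import Data.Fin.Properties using (any?)
open import Data.Fin.Subset using (_∈_; _∉_; _⊆_; _∩_; ∁; ⁅_⁆; Nonempty; Empty; inside; outside)
open import Data.Fin.Subset.Properties
open import Data.Nat.Base using (zero; suc; _*_; _<_; z≤n; s≤s)
open import Data.Nat.DivMod using (/-monoˡ-≤; m*n/n≡m)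
open import Data.Nat.Properties
open import Data.Product.Base using (∃-syntax; _,_; proj₂)
open import Data.Sum.Base using (_⊎_; inj₁; inj₂)
open import Data.Vec.Base using ([]; _∷_; here; there; lookup; tabulate)
open import Data.Vec.Properties using (lookup-zipWith; lookup∘tabulate; lookup⇒[]=; []=⇒lookup)
open import Function.Base using (_∘_)
open import Function.Bundles using (mk⇔)
open import Relation.Binary.PropositionalEquality using (_≢_; refl; sym; trans; cong; cong₂; subst; module ≡-Reasoning)
open import Relation.Nullary using (yes; no; contradiction)

open import Algebra.Properties.Semiring.Sum +-*-semiring using (sum; sum-cong-≗; ∑-comm; *-distribˡ-sum; *-distribʳ-sum)

private
  variable
    m n : ℕ

-- Cardinalities of finite subsets.

x∈p⇒0<∣p∣ : ∀ {x} {p : Subset n} → x ∈ p → 0 < ∣ p ∣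
x∈p⇒0<∣p∣ {x = x} x∈p = subst (_≤ _) (∣⁅x⁆∣≡1 x)
  (p⊆q⇒∣p∣≤∣q∣ λ y∈⁅x⁆ → subst (_∈ _) (sym (x∈⁅y⁆⇒x≡y x y∈⁅x⁆)) x∈p)

Empty⇒∣p∣≡0 : {p : Subset n} → Empty p → ∣ p ∣ ≡ 0
Empty⇒∣p∣≡0 {n} empty = trans (cong ∣_∣ (Empty-unique empty)) (∣⊥∣≡0 n)

subsingleton⇒∣p∣≤1 : (p : Subset n) → (∀ {x y} → x ∈ p → y ∈ p → x ≡ y) → ∣ p ∣ ≤ 1
subsingleton⇒∣p∣≤1 p unique with nonempty? p
... | no empty rewrite Empty⇒∣p∣≡0 empty = z≤n
... | yes (x , x∈p) = subst (∣ p ∣ ≤_) (∣⁅x⁆∣≡1 x)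
  (p⊆q⇒∣p∣≤∣q∣ λ y∈p → subst (_∈ ⁅ x ⁆) (unique x∈p y∈p) (x∈⁅x⁆ x))

-- Serves twice: to remove a point from a block, and to remove a fixed block from `S`.
∣p∣≤1+∣p∩∁⁅x⁆∣ : (p : Subset n) (x : Fin n) → ∣ p ∣ ≤ suc ∣ p ∩ ∁ ⁅ x ⁆ ∣
∣p∣≤1+∣p∩∁⁅x⁆∣ p x = go p (p ∩ ∁ ⁅ x ⁆) x
  (λ y∈p y≢x → x∈p∩q⁺ (y∈p , x∉p⇒x∈∁p (x≢y⇒x∉⁅y⁆ y≢x)))
  where
  -- Here `q` is any subset containing `p` up to `x`, so that the induction works with membership
  -- alone.
  go : ∀ {n} (p q : Subset n) x → (∀ {y} → y ∈ p → y ≢ x → y ∈ q) → ∣ p ∣ ≤ suc ∣ q ∣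
  go (s ∷ p) (t ∷ q) zero h = ≤-trans (∣s∷p∣≤1+∣p∣ s)
    (s≤s (≤-trans (p⊆q⇒∣p∣≤∣q∣ p⊆q) (∣p∣≤∣x∷p∣ t q)))
    where
    p⊆q : p ⊆ q
    p⊆q y∈p with there y∈q ← h (there y∈p) (λ ()) = y∈q
    ∣s∷p∣≤1+∣p∣ : ∀ s → ∣ s ∷ p ∣ ≤ suc ∣ p ∣
    ∣s∷p∣≤1+∣p∣ inside  = ≤-refl
    ∣s∷p∣≤1+∣p∣ outside = n≤1+n _
  go (s ∷ p) (t ∷ q) (suc x) h = step s t h (go p q x h′)
    where
    h′ : ∀ {y} → y ∈ p → y ≢ x → y ∈ q
    h′ y∈p y≢x with there y∈q ← h (there y∈p) (λ { refl → y≢x refl }) = y∈q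
    step : ∀ s t → (∀ {y} → y ∈ s ∷ p → y ≢ suc x → y ∈ t ∷ q) →
           ∣ p ∣ ≤ suc ∣ q ∣ → ∣ s ∷ p ∣ ≤ suc ∣ t ∷ q ∣
    step outside t       _ le = ≤-trans le (s≤s (∣p∣≤∣x∷p∣ t q))
    step inside  inside  _ le = s≤s le
    step inside  outside h _  with () ← h here (λ ())

-- Double counting of incidences.

indicator : Bool → ℕ
indicator true  = 1
indicator false = 0

indicator-∧ : ∀ a b → indicator (a ∧ b) ≡ indicator a * indicator b
indicator-∧ true  b = sym (+-identityʳ _)
indicator-∧ false b = refl

∣p∣≡∑ : (p : Subset n) → ∣ p ∣ ≡ sum (indicator ∘ lookup p)
∣p∣≡∑ []            = refl
∣p∣≡∑ (inside  ∷ p) = cong suc (∣p∣≡∑ p)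
∣p∣≡∑ (outside ∷ p) = ∣p∣≡∑ p

sum-mono-≤ : {f g : Fin n → ℕ} → (∀ i → f i ≤ g i) → sum f ≤ sum g
sum-mono-≤ {zero}  f≤g = z≤n
sum-mono-≤ {suc n} f≤g = +-mono-≤ (f≤g zero) (sum-mono-≤ (f≤g ∘ suc))

weighted-mono-≤ : (p : Subset n) {f g : Fin n → ℕ} → (∀ {i} → i ∈ p → f i ≤ g i) →
  sum (λ i → indicator (lookup p i) * f i) ≤ sum (λ i → indicator (lookup p i) * g i)
weighted-mono-≤ p {f} {g} f≤g = sum-mono-≤ pointwise
  where
  pointwise : ∀ i → indicator (lookup p i) * f i ≤ indicator (lookup p i) * g i
  pointwise i with lookup p i in eq
  ... | true  = *-monoʳ-≤ 1 (f≤g (lookup⇒[]= i p eq))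
  ... | false = z≤n

-- With the sets `M i` as the rows of an incidence matrix, these are its columns; for the blocks of
-- a design they are the pencils.
dual : (Fin m → Subset n) → Fin n → Subset m
dual M y = tabulate λ i → lookup (M i) y

∈-dual⁺ : (M : Fin m → Subset n) → ∀ {i y} → y ∈ M i → i ∈ dual M y
∈-dual⁺ M {i} y∈Mi = lookup⇒[]= i _ (trans (lookup∘tabulate _ i) ([]=⇒lookup y∈Mi))

∈-dual⁻ : (M : Fin m → Subset n) → ∀ {i y} → i ∈ dual M y → y ∈ M i
∈-dual⁻ M {i} {y} i∈ = lookup⇒[]= y _ (trans (sym (lookup∘tabulate _ i)) ([]=⇒lookup i∈))

∣p∩q∣≡∑ : (p q : Subset n) →
  ∣ p ∩ q ∣ ≡ sum (λ y → indicator (lookup p y) * indicator (lookup q y))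
∣p∩q∣≡∑ p q = trans (∣p∣≡∑ (p ∩ q)) (sum-cong-≗ λ y →
  trans (cong indicator (lookup-zipWith _∧_ y p q)) (indicator-∧ (lookup p y) (lookup q y)))

-- Both sides count the pairs `(i , y)` with `i ∈ A`, `y ∈ B` and `y ∈ M i`, first by `i`, then by
-- `y`. Written with 0/1 indicators, this is an exchange of two finite sums.
flags-comm : (M : Fin m → Subset n) (A : Subset m) (B : Subset n) →
  sum (λ i → indicator (lookup A i) * ∣ M i ∩ B ∣) ≡
  sum (λ y → indicator (lookup B y) * ∣ dual M y ∩ A ∣)
flags-comm M A B = begin
  sum (λ i → a i * ∣ M i ∩ B ∣)                  ≡⟨ sum-cong-≗ (λ i → cong (a i *_) (∣p∩q∣≡∑ (M i) B)) ⟩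
  sum (λ i → a i * sum (λ y → μ i y * b y))      ≡⟨ sum-cong-≗ (λ i → *-distribˡ-sum (a i) (λ y → μ i y * b y)) ⟩
  sum (λ i → sum (λ y → a i * (μ i y * b y)))    ≡⟨ ∑-comm (λ i y → a i * (μ i y * b y)) ⟩
  sum (λ y → sum (λ i → a i * (μ i y * b y)))    ≡⟨ sum-cong-≗ (λ y → sum-cong-≗ (λ i → rearrange i y)) ⟩
  sum (λ y → sum (λ i → b y * (ν y i * a i)))    ≡⟨ sum-cong-≗ (λ y → *-distribˡ-sum (b y) (λ i → ν y i * a i)) ⟨
  sum (λ y → b y * sum (λ i → ν y i * a i))      ≡⟨ sum-cong-≗ (λ y → cong (b y *_) (∣p∩q∣≡∑ (dual M y) A)) ⟨
  sum (λ y → b y * ∣ dual M y ∩ A ∣)             ∎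
  where
  open ≡-Reasoning
  a = indicator ∘ lookup A
  b = indicator ∘ lookup B
  μ = λ i y → indicator (lookup (M i) y)
  ν = λ y i → indicator (lookup (dual M y) i)
  rearrange : ∀ i y → a i * (μ i y * b y) ≡ b y * (ν y i * a i)
  rearrange i y = trans (*-comm (a i) (μ i y * b y))
    (trans (cong (_* a i) (*-comm (μ i y) (b y)))
    (trans (*-assoc (b y) (μ i y) (a i))
      (cong (λ t → b y * (indicator t * a i)) (sym (lookup∘tabulate _ i)))))

-- The number of incidences between `A` and `B` lies between the two products. Every counting
-- argument below is an instance with `c` or `d` equal to 1.
double-count : (M : Fin m → Subset n) (A : Subset m) (B : Subset n) (c d : ℕ) →
  (∀ {i} → i ∈ A → c ≤ ∣ M i ∩ B ∣) →
  (∀ {y} → y ∈ B → ∣ dual M y ∩ A ∣ ≤ d) →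
  ∣ A ∣ * c ≤ ∣ B ∣ * d
double-count M A B c d lower upper = begin
  ∣ A ∣ * c                                                    ≡⟨ constant A c ⟩
  sum (λ i → indicator (lookup A i) * c)                       ≤⟨ weighted-mono-≤ A lower ⟩
  sum (λ i → indicator (lookup A i) * ∣ M i ∩ B ∣)             ≡⟨ flags-comm M A B ⟩
  sum (λ y → indicator (lookup B y) * ∣ dual M y ∩ A ∣)        ≤⟨ weighted-mono-≤ B upper ⟩
  sum (λ y → indicator (lookup B y) * d)                       ≡⟨ constant B d ⟨
  ∣ B ∣ * d                                                    ∎
  where
  open ≤-Reasoning
  constant : ∀ {n} (p : Subset n) e → ∣ p ∣ * e ≡ sum (λ i → indicator (lookup p i) * e)
  constant p e = trans (cong (_* e) (∣p∣≡∑ p)) (*-distribʳ-sum e (indicator ∘ lookup p))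

-- Pencils of a design.

module _ {v k : ℕ} (D : Design v k) where
  open Design D

  pencil : Fin v → Subset b
  pencil = dual block

  block-unique : ∀ {x y} → x ≢ y → ∀ {i j} →
    x ∈ block i → y ∈ block i → x ∈ block j → y ∈ block j → i ≡ j
  block-unique x≢y x∈i y∈i x∈j y∈j with _ , _ , unique ← block-through x≢y =
    trans (sym (unique (x∈i , y∈i))) (unique (x∈j , y∈j))

  -- Two such blocks would share `x` and `y`, hence coincide. The set `p` is general so as to cover
  -- both a whole pencil and its part in `S`.
  ∣pencil∩pencil∩p∣≤1 : ∀ {x y} → x ≢ y → (p : Subset b) → p ⊆ pencil x → ∣ pencil y ∩ p ∣ ≤ 1
  ∣pencil∩pencil∩p∣≤1 {x} {y} x≢y p p⊆pencil = subsingleton⇒∣p∣≤1 _ λ i∈ j∈ →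
    block-unique x≢y (through-x i∈) (through-y i∈) (through-x j∈) (through-y j∈)
    where
    through-x : ∀ {i} → i ∈ pencil y ∩ p → x ∈ block i
    through-x i∈ = ∈-dual⁻ block (p⊆pencil (p∩q⊆q _ p i∈))
    through-y : ∀ {i} → i ∈ pencil y ∩ p → y ∈ block i
    through-y i∈ = ∈-dual⁻ block (p∩q⊆p _ p i∈)

  -- Each block through `x` has at least `k ∸ 1` further points, and no further point lies on two of
  -- these blocks. So the degree of `x` times `k ∸ 1` is at most `v ∸ 1`, and division by `k ∸ 1` is
  -- monotone.
  ∣pencil∣≤replication : ∀ x → ∣ pencil x ∣ ≤ replication
  ∣pencil∣≤replication x = subst (_≤ replication) (m*n/n≡m ∣ pencil x ∣ (k ∸ 1))
    (/-monoˡ-≤ (k ∸ 1) (≤-trans count (≤-reflexive (trans (*-identityʳ _) ∣others∣))))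
    where
    instance _ = k∸1-nonZero
    ∣others∣ : ∣ ∁ ⁅ x ⁆ ∣ ≡ v ∸ 1
    ∣others∣ = trans (∣∁p∣≡n∸∣p∣ ⁅ x ⁆) (cong (v ∸_) (∣⁅x⁆∣≡1 x))
    count : ∣ pencil x ∣ * (k ∸ 1) ≤ ∣ ∁ ⁅ x ⁆ ∣ * 1
    count = double-count block (pencil x) (∁ ⁅ x ⁆) (k ∸ 1) 1
      (λ {i} _ → ∸-monoˡ-≤ 1 (≤-trans (≤-reflexive (sym (block-size i))) (∣p∣≤1+∣p∩∁⁅x⁆∣ (block i) x)))
      (λ y∈ → ∣pencil∩pencil∩p∣≤1 (x∉⁅y⁆⇒x≢y (x∈∁p⇒x∉p y∈) ∘ sym) (pencil x) ⊆-refl)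

  -- If a block through `x` were missing from `S`, the pencil would have more than `replication`
  -- blocks.
  ⊆pencil∧∣S∣≡replication⇒IsPointPencil : ∀ {S x} → S ⊆ pencil x → ∣ S ∣ ≡ replication →
    IsPointPencil S
  ⊆pencil∧∣S∣≡replication⇒IsPointPencil {S} {x} S⊆ ∣S∣≡r =
    x , λ i → mk⇔ (∈-dual⁻ block ∘ S⊆) (⊇ i)
    where
    ⊇ : ∀ i → x ∈ block i → i ∈ S
    ⊇ i x∈i with i ∈? S
    ... | yes i∈S = i∈S
    ... | no  i∉S = contradiction
      (p⊂q⇒∣p∣<∣q∣ (S⊆ , i , ∈-dual⁺ block x∈i , i∉S))
      (≤⇒≯ (subst (_ ≤_) (sym ∣S∣≡r) (∣pencil∣≤replication x)))

  -- Blocks of an Erdős-Ko-Rado set through a point.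

  module _ (S : Subset b) (ekr : IsErdősKoRado S) where

    large-degree⇒⊆pencil : ∀ {x} → k < ∣ pencil x ∩ S ∣ → S ⊆ pencil x
    large-degree⇒⊆pencil {x} k< {i} i∈S with x ∈? block i
    ... | yes x∈i = ∈-dual⁺ block x∈i
    ... | no  x∉i = contradiction k< (≤⇒≯ (subst (_ ≤_) (block-size i)
      (subst (_≤ _) (*-identityʳ _) (subst (_ ≤_) (*-identityʳ _) count))))
      where
      meets : ∀ {j} → j ∈ pencil x ∩ S → Nonempty (block j ∩ block i)
      meets j∈ with j∈pencil , j∈S ← x∈p∩q⁻ (pencil x) S j∈ =
        ekr j∈S i∈S λ { refl → x∉i (∈-dual⁻ block j∈pencil) }
      -- A block of `S` through `x` differs from `block i` and therefore meets it. A point of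
      -- `block i` differs from `x`, so at most one of these blocks passes through it.
      count : ∣ pencil x ∩ S ∣ * 1 ≤ ∣ block i ∣ * 1
      count = double-count block (pencil x ∩ S) (block i) 1 1
        (λ j∈ → x∈p⇒0<∣p∣ (proj₂ (meets j∈)))
        (λ y∈i → ∣pencil∩pencil∩p∣≤1 (λ { refl → x∉i y∈i }) (pencil x ∩ S) (p∩q⊆p (pencil x) S))

    small-degrees⇒bound : (∀ x → ∣ pencil x ∩ S ∣ ≤ k) → ∣ S ∣ ≤ suc (k * (k ∸ 1))
    small-degrees⇒bound degree≤k with nonempty? S
    ... | no empty rewrite Empty⇒∣p∣≡0 empty = z≤n
    ... | yes (i , i∈S) = begin
      ∣ S ∣                        ≤⟨ ∣p∣≤1+∣p∩∁⁅x⁆∣ S i ⟩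
      suc ∣ others ∣               ≡⟨ cong suc (*-identityʳ _) ⟨
      suc (∣ others ∣ * 1)         ≤⟨ s≤s (double-count block others (block i) 1 (k ∸ 1) meets degree) ⟩
      suc (∣ block i ∣ * (k ∸ 1))  ≡⟨ cong (λ t → suc (t * (k ∸ 1))) (block-size i) ⟩
      suc (k * (k ∸ 1))            ∎
      where
      open ≤-Reasoning
      others = S ∩ ∁ ⁅ i ⁆
      i∉others : i ∉ others
      i∉others i∈ = x∈∁p⇒x∉p (p∩q⊆q S _ i∈) (x∈⁅x⁆ i)
      meets : ∀ {j} → j ∈ others → 1 ≤ ∣ block j ∩ block i ∣
      meets j∈ = x∈p⇒0<∣p∣ (proj₂ (ekr (p∩q⊆p S _ j∈) i∈S λ { refl → i∉others j∈ }))
      degree : ∀ {y} → y ∈ block i → ∣ pencil y ∩ others ∣ ≤ k ∸ 1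
      -- The index `i` itself lies in `pencil y ∩ S` but not in `others`; this strict inclusion
      -- lowers the bound from `k` to `k ∸ 1`.
      degree {y} y∈i = ∸-monoˡ-≤ 1 (≤-trans (p⊂q⇒∣p∣<∣q∣
        ( (λ j∈ → x∈p∩q⁺ (p∩q⊆p (pencil y) others j∈ , p∩q⊆p S _ (p∩q⊆q (pencil y) others j∈)))
        , i , x∈p∩q⁺ (∈-dual⁺ block y∈i , i∈S) , i∉others ∘ p∩q⊆q (pencil y) others))
        (degree≤k y))

    ⊆pencil⊎bound : (∃[ x ] S ⊆ pencil x) ⊎ ∣ S ∣ ≤ k ^ 2 ∸ k + 1
    ⊆pencil⊎bound with any? (λ x → k <? ∣ pencil x ∩ S ∣)
    ... | yes (x , k<) = inj₁ (x , large-degree⇒⊆pencil k<)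
    ... | no  none     = inj₂ (subst (∣ S ∣ ≤_) rewritten
      (small-degrees⇒bound λ x → ≮⇒≥ λ k< → none (x , k<)))
      where
      rewritten : suc (k * (k ∸ 1)) ≡ k ^ 2 ∸ k + 1
      -- `k ^ 2` unfolds to `k * (k * 1)`, which accounts for the factors of 1.
      rewritten = trans (cong suc (trans (*-distribˡ-∸ k k 1)
        (cong₂ _∸_ (cong (k *_) (sym (*-identityʳ k))) (*-identityʳ k)))) (+-comm 1 _)

theorem5p1 : ∀ (v k : ℕ) (D : Design v k) (S : Subset (Design.b D)) →
    Design.IsErdősKoRado D S →
    (Design.replication D ≥ k ^ 2 ∸ k + 1 → ∣ S ∣ ≤ Design.replication D)
    ×
    (Design.replication D > k ^ 2 ∸ k + 1 → ∣ S ∣ ≡ Design.replication D →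
    Design.IsPointPencil D S)
theorem5p1 v k D S ekr with ⊆pencil⊎bound D S ekr
... | inj₁ (x , S⊆) =
  (λ _ → ≤-trans (p⊆q⇒∣p∣≤∣q∣ S⊆) (∣pencil∣≤replication D x)) ,
  (λ _ → ⊆pencil∧∣S∣≡replication⇒IsPointPencil D S⊆)
... | inj₂ bound =
  (λ r≥ → ≤-trans bound r≥) ,
  -- A set of size `replication` would force `replication` to be at most `k ^ 2 ∸ k + 1`.
  (λ r> ∣S∣≡r → contradiction r> (≤⇒≯ (subst (_≤ _) ∣S∣≡r bound)))
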